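{- For $n\ge2$ let $\mathbf I(n)$ be the number of idempotent residuated chains with $n$ elements, up to isomorphism. Then the sequence $(\mathbf I(n):n\ge2)$ satisfies $\mathbf I(2)=1$, $\mathbf I(3)=2$, and $\mathbf I(n+2)=2\,\mathbf I(n)+2\,\mathbf I(n+1)$ for all $n\ge2$, and for every $n\ge2$, $$\mathbf I(n)=\frac{(1+\sqrt3)^{n-1}-(1-\sqrt3)^{n-1}}{2\sqrt3}.$$
   Context: A residuated lattice is an algebra $\mathbf A=\langle A,\wedge,\vee,\cdot,\backslash,/,\mathrm e\rangle$ such that $\langle A,\wedge,\vee\rangle$ is a lattice, $\langle A,\cdot,\mathrm e\rangle$ is a monoid, and for all $a,b,c\in A$: $b\le a\backslash c\iff a\cdot b\le c\iff a\le c/b$. It is idempotent if $aa=a$ for all $a$, and a residuated chain if its lattice order is total (commutativity is not assumed). -}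

module Defs where

open import Algebra.Definitions using (Idempotent)
open import Algebra.Lattice.Structures using (IsLattice)
open import Algebra.Structures using (IsMonoid)
open import Data.Fin.Base using (Fin)
open import Data.Fin.Properties using (injective⇒≤)
open import Data.Integer.Base using (+_)
open import Data.Nat.Base as ℕ using (ℕ; zero; suc)
open import Data.Nat.Properties using (≤-antisym)
open import Data.Product.Base using (Σ-syntax; _×_; proj₁; proj₂)
open import Data.Rational.Base as ℚ using (ℚ; 0ℚ; 1ℚ; 1/_; NonZero)
import Data.Rational.Properties as ℚₚ
open import Data.Rational.Solver using (module +-*-Solver)
open import Function.Base using (_∘_)
open import Function.Bundles using (_⇔_; _⤖_; _↔_; Bijection; Inverse)
open import Function.Construct.Composition using (_↔-∘_)
open import Function.Construct.Identity using (↔-id)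
open import Function.Construct.Symmetry using (↔-sym)
open import Relation.Binary.Bundles using (Setoid)
import Relation.Binary.Construct.On as On
open import Relation.Binary.Definitions using (Total)
open import Relation.Binary.PropositionalEquality
  using (_≡_; refl; sym; trans; cong; cong₂; module ≡-Reasoning)
import Relation.Binary.PropositionalEquality as ≡

------------------------------------------------------------------------
-- Residuated lattices

record ResiduatedLattice : Set₁ where
  infixl 7 _·_ _\\_ _//_
  infixr 6 _∧_ _∨_
  infix  4 _≤_
  field
    Carrier : Set
    _∧_ _∨_ _·_ _\\_ _//_ : Carrier → Carrier → Carrier
    e         : Carrier
    isLattice : IsLattice _≡_ _∨_ _∧_
    isMonoid  : IsMonoid _≡_ _·_ e

  _≤_ : Carrier → Carrier → Set
  a ≤ b = a ∧ b ≡ a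

  field
    residual-\\ : ∀ a b c → (b ≤ a \\ c) ⇔ (a · b ≤ c)
    residual-// : ∀ a b c → (a · b ≤ c) ⇔ (a ≤ c // b)

record IsIdempotentResiduatedChain (A : ResiduatedLattice) : Set where
  open ResiduatedLattice A
  field
    idempotent : Idempotent _≡_ _·_
    total      : Total _≤_

infix 4 _≅_
record _≅_ (A B : ResiduatedLattice) : Set where
  private
    module A = ResiduatedLattice A
    module B = ResiduatedLattice B
  field
    bijection : A.Carrier ↔ B.Carrier
  open Inverse bijection public using (to; from; strictlyInverseˡ; strictlyInverseʳ)
  field
    ∧-homo  : ∀ x y → to (x A.∧ y) ≡ to x B.∧ to y
    ∨-homo  : ∀ x y → to (x A.∨ y) ≡ to x B.∨ to y
    ·-homo  : ∀ x y → to (x A.· y) ≡ to x B.· to y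
    \\-homo : ∀ x y → to (x A.\\ y) ≡ to x B.\\ to y
    //-homo : ∀ x y → to (x A.// y) ≡ to x B.// to y
    e-homo  : to A.e ≡ B.e

≅-refl : ∀ {A} → A ≅ A
≅-refl = record
  { bijection = ↔-id _
  ; ∧-homo = λ _ _ → refl ; ∨-homo = λ _ _ → refl ; ·-homo = λ _ _ → refl
  ; \\-homo = λ _ _ → refl ; //-homo = λ _ _ → refl ; e-homo = refl
  }

≅-sym : ∀ {A B} → A ≅ B → B ≅ A
≅-sym {A} {B} i = record
  { bijection = ↔-sym bijection
  ; ∧-homo = flip A._∧_ B._∧_ ∧-homo ; ∨-homo = flip A._∨_ B._∨_ ∨-homo
  ; ·-homo = flip A._·_ B._·_ ·-homo
  ; \\-homo = flip A._\\_ B._\\_ \\-homo ; //-homo = flip A._//_ B._//_ //-homo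
  ; e-homo = trans (cong from (sym e-homo)) (strictlyInverseʳ A.e)
  }
  where
  open _≅_ i
  module A = ResiduatedLattice A
  module B = ResiduatedLattice B
  flip : (f : A.Carrier → A.Carrier → A.Carrier) (g : B.Carrier → B.Carrier → B.Carrier) →
         (∀ x y → to (f x y) ≡ g (to x) (to y)) →
         ∀ x y → from (g x y) ≡ f (from x) (from y)
  flip f g homo x y = begin
    from (g x y)                       ≡⟨ cong from (cong₂ g (strictlyInverseˡ x) (strictlyInverseˡ y)) ⟨
    from (g (to (from x)) (to (from y))) ≡⟨ cong from (homo (from x) (from y)) ⟨
    from (to (f (from x) (from y)))    ≡⟨ strictlyInverseʳ _ ⟩
    f (from x) (from y)                ∎
    where open ≡-Reasoning

≅-trans : ∀ {A B C} → A ≅ B → B ≅ C → A ≅ C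
≅-trans i j = record
  { bijection = J.bijection ↔-∘ I.bijection
  ; ∧-homo  = λ x y → trans (cong J.to (I.∧-homo x y)) (J.∧-homo _ _)
  ; ∨-homo  = λ x y → trans (cong J.to (I.∨-homo x y)) (J.∨-homo _ _)
  ; ·-homo  = λ x y → trans (cong J.to (I.·-homo x y)) (J.·-homo _ _)
  ; \\-homo = λ x y → trans (cong J.to (I.\\-homo x y)) (J.\\-homo _ _)
  ; //-homo = λ x y → trans (cong J.to (I.//-homo x y)) (J.//-homo _ _)
  ; e-homo  = trans (cong J.to I.e-homo) J.e-homo
  }
  where
  module I = _≅_ i
  module J = _≅_ j

------------------------------------------------------------------------
-- Counting up to isomorphism

IdempotentResiduatedChain : ℕ → Set₁
IdempotentResiduatedChain n =
  Σ[ A ∈ ResiduatedLattice ]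
    IsIdempotentResiduatedChain A × (ResiduatedLattice.Carrier A ⤖ Fin n)

-- Two n-element chains are equal here when they are isomorphic as residuated
-- lattices; the chosen enumeration by Fin n plays no role.
chainSetoid : ℕ → Setoid _ _
chainSetoid n = On.setoid {B = IdempotentResiduatedChain n} ≅-setoid proj₁
  where
  ≅-setoid : Setoid _ _
  ≅-setoid = record
    { Carrier = ResiduatedLattice
    ; _≈_ = _≅_
    ; isEquivalence = record { refl = ≅-refl ; sym = ≅-sym ; trans = ≅-trans }
    }

-- A bijection of setoids into Fin k identifies exactly the isomorphic chains
-- and hits every index, so it says that there are k isomorphism classes.
HasIsoClasses : (n k : ℕ) → Set₁
HasIsoClasses n k = Bijection (chainSetoid n) (≡.setoid (Fin k))

HasIsoClasses-unique : ∀ {n k l} → HasIsoClasses n k → HasIsoClasses n l → k ≡ l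
HasIsoClasses-unique f g = ≤-antisym (below f g) (below g f)
  where
  below : ∀ {n k l} → HasIsoClasses n k → HasIsoClasses n l → k ℕ.≤ l
  below f g = injective⇒≤ {f = G.to ∘ F.to⁻} λ {i} {j} eq →
    trans (sym (section i))
      (trans (F.cong {F.to⁻ i} {F.to⁻ j} (G.injective {F.to⁻ i} {F.to⁻ j} eq)) (section j))
    where
    module F = Bijection f
    module G = Bijection g
    section : ∀ i → F.to (F.to⁻ i) ≡ i
    section = proj₂ ∘ F.strictlySurjective

------------------------------------------------------------------------
-- The field ℚ(√3), the subfield of ℝ in which the closed formula lives

infix 8 _+_√3
record ℚ[√3] : Set where
  constructor _+_√3
  field
    rational irrational : ℚ

open ℚ[√3]

fromℚ : ℚ → ℚ[√3]
fromℚ q = q + 0ℚ √3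

fromℕ : ℕ → ℚ[√3]
fromℕ n = fromℚ (+ n ℚ./ 1)

√3 : ℚ[√3]
√3 = 0ℚ + 1ℚ √3

infixl 6 _⊕_ _⊖_
infixl 7 _⊗_ _⊘_
infixr 8 _↑_

_⊕_ _⊖_ _⊗_ : ℚ[√3] → ℚ[√3] → ℚ[√3]
(a + b √3) ⊕ (c + d √3) = (a ℚ.+ c) + (b ℚ.+ d) √3
(a + b √3) ⊖ (c + d √3) = (a ℚ.- c) + (b ℚ.- d) √3
(a + b √3) ⊗ (c + d √3) =
  (a ℚ.* c ℚ.+ (+ 3 ℚ./ 1) ℚ.* (b ℚ.* d)) + (a ℚ.* d ℚ.+ b ℚ.* c) √3

_↑_ : ℚ[√3] → ℕ → ℚ[√3]
x ↑ zero  = fromℕ 1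
x ↑ suc n = x ⊗ x ↑ n

norm : ℚ[√3] → ℚ
norm (a + b √3) = a ℚ.* a ℚ.- (+ 3 ℚ./ 1) ℚ.* (b ℚ.* b)

-- x / y is x times the conjugate of y, divided by the rational norm of y;
-- since √3 is irrational, the norm vanishes only at y = 0.
_⊘_ : (x y : ℚ[√3]) .{{_ : NonZero (norm y)}} → ℚ[√3]
x ⊘ y = x ⊗ (rational y + (ℚ.- irrational y) √3) ⊗ fromℚ (1/ norm y)

√3-square : √3 ⊗ √3 ≡ fromℕ 3
√3-square = refl

⊘-⊗-cancel : ∀ x y .{{_ : NonZero (norm y)}} → (x ⊘ y) ⊗ y ≡ x
⊘-⊗-cancel x@(a + b √3) y@(c + d √3) = cong₂ _+_√3
  (trans (first a b c d (1/ norm y)) (cancel a))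
  (trans (second a b c d (1/ norm y)) (cancel b))
  where
  open +-*-Solver
  three : ∀ {m} → Polynomial m
  three = con (+ 3 ℚ./ 1)

  cancel : ∀ p → p ℚ.* (norm y ℚ.* 1/ norm y) ≡ p
  cancel p = trans (cong (p ℚ.*_) (ℚₚ.*-inverseʳ (norm y))) (ℚₚ.*-identityʳ p)

  first : ∀ a b c d i →
          rational (((a + b √3) ⊗ (c + (ℚ.- d) √3) ⊗ fromℚ i) ⊗ (c + d √3)) ≡
          a ℚ.* (norm (c + d √3) ℚ.* i)
  first = solve 5 (λ a b c d i →
    let u = a :* c :+ three :* (b :* (:- d))
        v = a :* (:- d) :+ b :* c
    in  (u :* i :+ three :* (v :* con 0ℚ)) :* c
          :+ three :* ((u :* con 0ℚ :+ v :* i) :* d)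
        := a :* ((c :* c :- three :* (d :* d)) :* i)) refl

  second : ∀ a b c d i →
           irrational (((a + b √3) ⊗ (c + (ℚ.- d) √3) ⊗ fromℚ i) ⊗ (c + d √3)) ≡
           b ℚ.* (norm (c + d √3) ℚ.* i)
  second = solve 5 (λ a b c d i →
    let u = a :* c :+ three :* (b :* (:- d))
        v = a :* (:- d) :+ b :* c
    in  (u :* i :+ three :* (v :* con 0ℚ)) :* d
          :+ (u :* con 0ℚ :+ v :* i) :* c
        := b :* ((c :* c :- three :* (d :* d)) :* i)) refl

{-# OPTIONS --safe #-}

-- In an idempotent totally ordered monoid x · y is x or y, so any two elements
-- are comparable with respect to absorption. Elements on the same side of e
-- absorb each other strictly, the one further from e being the stronger, hence
-- an absorption class contains at most one element on each side of e, and if it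
-- has two, their product is always the left or always the right factor. A finite
-- such monoid is therefore a stack of layers around e, of four kinds: a single
-- element above or below everything weaker (size 1), or one of each, left or
-- right (size 2), and every such stack occurs. It is residuated precisely when
-- the least element is absorbing, that is, when the outermost layer is a single
-- negative element. Besides e and this element there remain arbitrary layers of
-- total size n − 2, and splitting off the outermost of these gives the recurrence.
module Submission where

open import Data.Nat using (ℕ; _+_; _*_; _∸_; _≤_)
open import Data.Product using (Σ-syntax; _×_)
open import Relation.Binary.PropositionalEquality using (_≡_)
open import Defs

import Algebra.Construct.Flip.Op as FlipOp
import Algebra.Construct.NaturalChoice.Max as Max
import Algebra.Construct.NaturalChoice.Min as Min
import Algebra.Construct.NaturalChoice.MinOp as MinOp
open import Algebra.Definitions using (Idempotent)
import Algebra.Lattice.Construct.NaturalChoice.MinMaxOp as MinMaxOp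
open import Algebra.Lattice.Structures using (IsLattice)
open import Algebra.Structures using (IsMonoid)
open import Data.Fin using (Fin; zero; suc)
open import Data.Fin.Permutation using (↔⇒≡)
open import Data.Fin.Properties using (inj⇒≟; injective⇒≤; +↔⊎; *↔×)
import Data.Integer as ℤ
import Data.Integer.Properties as ℤₚ
open import Data.List using (List; []; _∷_)
open import Data.Nat using (zero; suc; _<_; s≤s)
open import Data.Nat.Coprimality using (1-coprimeTo) renaming (sym to coprime-sym)
open import Data.Nat.Properties
  using (≤-refl; ≤-trans; ≤-reflexive; ≡-irrelevant; suc-injective; n≮n; n<1+n; m<n⇒m<1+n;
         +-comm; +-suc; +-identityʳ; +-monoˡ-≤)
open import Data.Product using (∃-syntax; _,_; proj₁; proj₂; swap)
open import Data.Product.Function.NonDependent.Propositional using (_×-↔_)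
open import Data.Rational as ℚ using (ℚ; mkℚ; _/_)
import Data.Rational.Properties as ℚₚ
open import Data.Rational.Solver using (module +-*-Solver)
open import Data.Sign.Base using (Sign; opposite) renaming (+ to pos; - to neg)
open import Data.Sign.Properties using (opposite-selfInverse)
open import Data.Sum as Sum using (_⊎_; inj₁; inj₂)
open import Data.Sum.Function.Propositional using (_⊎-↔_)
open import Data.Unit using (tt)
open import Function using (_∘_; flip; _↔_; mk⇔; mk↔ₛ′; Inverse; Injection; Equivalence)
open import Function.Properties.Bijection using (⤖⇒↔)
open import Function.Properties.Inverse using (↔-sym; ↔-trans; ↔⇒↣; ↔⇒⤖)
open import Relation.Binary.Bundles using (TotalOrder)
import Relation.Binary.Construct.Flip.EqAndOrd as Dual
open import Relation.Binary.Definitions using (Decidable; DecidableEquality)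
open import Relation.Binary.PropositionalEquality
  using (_≢_; refl; sym; trans; cong; cong₂; isEquivalence; subst; subst₂; module ≡-Reasoning)
open import Relation.Binary.Structures using (IsTotalOrder)
open import Relation.Nullary using (¬_; Dec; yes; no; contradiction; _×-dec_)

-- Finite idempotent totally ordered monoids

record FiniteTomonoid : Set₁ where
  infix 4 _⊑_ _≟_ _⊑?_ _absorbs_
  infixl 7 _∙_
  field
    Carrier      : Set
    _⊑_          : Carrier → Carrier → Set
    _∙_          : Carrier → Carrier → Carrier
    e            : Carrier
    isTotalOrder : IsTotalOrder _≡_ _⊑_
    isMonoid     : IsMonoid _≡_ _∙_ e
    idem         : Idempotent _≡_ _∙_
    mono         : ∀ {x x′ y y′} → x ⊑ x′ → y ⊑ y′ → x ∙ y ⊑ x′ ∙ y′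
    {order}      : ℕ
    finite       : Carrier ↔ Fin order

  open IsTotalOrder isTotalOrder public using (antisym; total)
    renaming (refl to ⊑-refl; trans to ⊑-trans; reflexive to ⊑-reflexive)
  open IsMonoid isMonoid public using (assoc; identityˡ; identityʳ)

  _≟_ : DecidableEquality Carrier
  _≟_ = inj⇒≟ (↔⇒↣ finite)

  _⊑?_ : Decidable _⊑_
  x ⊑? y with total x y | x ≟ y
  ... | inj₁ x⊑y | _        = yes x⊑y
  ... | inj₂ _   | yes refl = yes ⊑-refl
  ... | inj₂ y⊑x | no x≢y   = no λ x⊑y → x≢y (antisym x⊑y y⊑x)

  -- Exhaustive search along the enumeration. Applied to `orient neg` it finds greatest elements:
  -- the nearest ones below `e`, and later the residuals.
  least : {P : Carrier → Set} → (∀ x → Dec (P x)) →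
          (∀ x → ¬ P x) ⊎ ∃[ m ] P m × (∀ x → P x → m ⊑ x)
  least {P} P? with search from
    where
    open Inverse finite using (from)
    search : ∀ {k} (g : Fin k → Carrier) →
             (∀ i → ¬ P (g i)) ⊎ ∃[ m ] P m × (∀ i → P (g i) → m ⊑ g i)
    search {zero}  g = inj₁ λ ()
    search {suc k} g with P? (g zero) | search (g ∘ suc)
    ... | no ¬p | inj₁ none = inj₁ λ { zero → ¬p ; (suc i) → none i }
    ... | no ¬p | inj₂ (m , pm , min) =
      inj₂ (m , pm , λ { zero p → contradiction p ¬p ; (suc i) → min i })
    ... | yes p | inj₁ none =
      inj₂ (g zero , p , λ { zero _ → ⊑-refl ; (suc i) q → contradiction q (none i) })
    ... | yes p | inj₂ (m , pm , min) with total (g zero) m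
    ...   | inj₁ g₀⊑m =
      inj₂ (g zero , p , λ { zero _ → ⊑-refl ; (suc i) q → ⊑-trans g₀⊑m (min i q) })
    ...   | inj₂ m⊑g₀ = inj₂ (m , pm , λ { zero _ → m⊑g₀ ; (suc i) → min i })
  ... | inj₁ none =
    inj₁ λ x p → none (to x) (subst P (sym (strictlyInverseʳ x)) p)
    where open Inverse finite
  ... | inj₂ (m , pm , min) =
    inj₂ (m , pm , λ x p → subst (m ⊑_) (strictlyInverseʳ x)
                              (min (to x) (subst P (sym (strictlyInverseʳ x)) p)))
    where open Inverse finite

  _absorbs_ : Carrier → Carrier → Set
  x absorbs y = x ∙ y ≡ x × y ∙ x ≡ x

op : FiniteTomonoid → FiniteTomonoid
op T = record
  { isTotalOrder = isTotalOrder
  ; isMonoid     = FlipOp.isMonoid isMonoid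
  ; idem         = idem
  ; mono         = flip mono
  ; finite       = finite
  } where open FiniteTomonoid T

-- The order read away from e, so that statements about elements above e also
-- cover those below; only the order depends on the sign.
orient : Sign → FiniteTomonoid → FiniteTomonoid
orient s T = record
  { _⊑_          = _⊑ₛ_ s
  ; isTotalOrder = total-order s
  ; isMonoid     = isMonoid
  ; idem         = idem
  ; mono         = λ {x} {x′} {y} {y′} → mono-order s {x} {x′} {y} {y′}
  ; finite       = finite
  }
  where
  open FiniteTomonoid T
  _⊑ₛ_ : Sign → Carrier → Carrier → Set
  _⊑ₛ_ pos = _⊑_
  _⊑ₛ_ neg = flip _⊑_

  total-order : ∀ s → IsTotalOrder _≡_ (_⊑ₛ_ s)
  total-order pos = isTotalOrder
  total-order neg = Dual.isTotalOrder isTotalOrder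

  mono-order : ∀ s {x x′ y y′} → (_⊑ₛ_ s) x x′ → (_⊑ₛ_ s) y y′ → (_⊑ₛ_ s) (x ∙ y) (x′ ∙ y′)
  mono-order pos = mono
  mono-order neg = mono

-- Products select a factor, and absorption on either side of the unit

module _ (T : FiniteTomonoid) where
  open FiniteTomonoid T

  -- If `e ⊑ x ∙ y`, multiplying by `y` on the right gives `y ⊑ x ∙ y`, while `x ∙ y ⊑ y ∙ y` is the
  -- other bound. If `x ∙ y ⊑ e`, multiplying by `x` on the left gives `x ∙ y ⊑ x`, and
  -- `x ∙ x ⊑ x ∙ y`.
  conservative-⊑ : ∀ {x y} → x ⊑ y → x ∙ y ≡ x ⊎ x ∙ y ≡ y
  conservative-⊑ {x} {y} x⊑y with total e (x ∙ y)
  ... | inj₁ e⊑xy = inj₂ (antisym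
          (subst (x ∙ y ⊑_) (idem y) (mono x⊑y ⊑-refl))
          (subst₂ _⊑_ (identityˡ y) (trans (assoc x y y) (cong (x ∙_) (idem y)))
            (mono e⊑xy ⊑-refl)))
  ... | inj₂ xy⊑e = inj₁ (antisym
          (subst₂ _⊑_ (trans (sym (assoc x x y)) (cong (_∙ y) (idem x))) (identityʳ x)
            (mono ⊑-refl xy⊑e))
          (subst (_⊑ x ∙ y) (idem x) (mono ⊑-refl x⊑y)))

  -- Each product is squeezed between the values obtained on replacing `p` by `e` and by `c`, and
  -- both of these are `c`.
  above-absorbs : ∀ {p c} → e ⊑ p → p ⊑ c → c absorbs p
  above-absorbs {p} {c} e⊑p p⊑c =
    antisym (subst (c ∙ p ⊑_) (idem c) (mono ⊑-refl p⊑c))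
            (subst (_⊑ c ∙ p) (identityʳ c) (mono ⊑-refl e⊑p)) ,
    antisym (subst (p ∙ c ⊑_) (idem c) (mono p⊑c ⊑-refl))
            (subst (_⊑ p ∙ c) (identityˡ c) (mono e⊑p ⊑-refl))

-- Passing to `op` exchanges the factors but keeps the order, which reduces the case `y ⊑ x` to the
-- other one.
conservative : ∀ T → let open FiniteTomonoid T in ∀ x y → x ∙ y ≡ x ⊎ x ∙ y ≡ y
conservative T x y with FiniteTomonoid.total T x y
... | inj₁ x⊑y = conservative-⊑ T x⊑y
... | inj₂ y⊑x with conservative-⊑ (op T) y⊑x
...   | inj₁ eq = inj₂ eq
...   | inj₂ eq = inj₁ eq

module _ (T : FiniteTomonoid) where
  open FiniteTomonoid T

  -- If `c ∙ n` were `n`, then `p ≡ p ∙ n ⊑ c ∙ n ≡ n ⊑ e ⊑ p` would force `n ≡ p`.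
  cross : ∀ {p c n} → e ⊑ p → p ⊑ c → n ⊑ e → n ≢ p → p ∙ n ≡ p → c ∙ n ≡ c
  cross {p} {c} {n} e⊑p p⊑c n⊑e n≢p pn≡p with conservative T c n
  ... | inj₁ cn≡c = cn≡c
  ... | inj₂ cn≡n = contradiction
          (antisym (⊑-trans n⊑e e⊑p) (subst₂ _⊑_ pn≡p cn≡n (mono p⊑c ⊑-refl))) n≢p

  -- Were n ∙ c equal to n, then p ≡ p ∙ n ≡ p ∙ n ∙ c ≡ p ∙ c ≡ c.
  cross-absorbs : ∀ {p c n} → e ⊑ p → p ⊑ c → n ⊑ e → n ≢ p → p ≢ c →
                  p ∙ n ≡ p → c absorbs n
  cross-absorbs {p} {c} {n} e⊑p p⊑c n⊑e n≢p p≢c pn≡p = cross e⊑p p⊑c n⊑e n≢p pn≡p , nc≡c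
    where
    nc≡c : n ∙ c ≡ c
    nc≡c with conservative T n c
    ... | inj₂ nc≡c = nc≡c
    ... | inj₁ nc≡n = contradiction p≡c p≢c
      where
      open ≡-Reasoning
      p≡c : p ≡ c
      p≡c = begin
        p           ≡⟨ pn≡p ⟨
        p ∙ n       ≡⟨ cong (p ∙_) nc≡n ⟨
        p ∙ (n ∙ c) ≡⟨ assoc p n c ⟨
        p ∙ n ∙ c   ≡⟨ cong (_∙ c) pn≡p ⟩
        p ∙ c       ≡⟨ proj₂ (above-absorbs T e⊑p p⊑c) ⟩
        c           ∎

-- Words of layers and the tomonoids they describe

-- A layer is a set of at most one element above and one below the unit which
-- absorb each other from one side; the product of two elements of
-- double left (double right) is the left (right) factor.
data Side : Set where
  left right : Side

data Layer : Set where
  single : Sign → Layer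
  double : Side → Layer

-- Words list the layers from the outermost, most absorbing one.
Word : Set
Word = List Layer

infix 4 _∋_
data _∋_ : Layer → Sign → Set where
  +ₛ   : single pos ∋ pos
  -ₛ   : single neg ∋ neg
  both : ∀ {d s} → double d ∋ s

data El : Word → Set where
  ε     : El []
  inner : ∀ {l w} → El w → El (l ∷ w)
  outer : ∀ {l w} s → l ∋ s → El (l ∷ w)

∋-irrelevant : ∀ {l s} (h k : l ∋ s) → h ≡ k
∋-irrelevant +ₛ   +ₛ   = refl
∋-irrelevant -ₛ   -ₛ   = refl
∋-irrelevant both both = refl

unit : ∀ w → El w
unit []      = ε
unit (_ ∷ w) = inner (unit w)

infix 4 _≼_
data _≼_ : ∀ {w} → El w → El w → Set where
  ε≼ε    : ε ≼ ε
  inner≼ : ∀ {l w} {x y : El w} → x ≼ y → inner {l} x ≼ inner y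
  bot≼   : ∀ {l w h} {x : El (l ∷ w)} → outer neg h ≼ x
  ≼top   : ∀ {l w h} {x : El (l ∷ w)} → x ≼ outer pos h

-- As used in `_⋆_`, the two factors coincide when the layer is `single`, so the catch-all clause
-- may return either.
merge : Layer → {A : Set} → A → A → A
merge (double right) x y = y
merge _              x y = x

infixl 7 _⋆_
_⋆_ : ∀ {w} → El w → El w → El w
ε               ⋆ ε         = ε
inner x         ⋆ inner y   = inner (x ⋆ y)
inner _         ⋆ outer t k = outer t k
outer s h       ⋆ inner _   = outer s h
_⋆_ {l ∷ _} (outer s h) (outer t k) = merge l (outer s h) (outer t k)

≼-refl : ∀ {w} (x : El w) → x ≼ x
≼-refl ε             = ε≼ε
≼-refl (inner x)     = inner≼ (≼-refl x)
≼-refl (outer pos _) = ≼top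
≼-refl (outer neg _) = bot≼

≼-trans : ∀ {w} {x y z : El w} → x ≼ y → y ≼ z → x ≼ z
≼-trans ε≼ε        q          = q
≼-trans (inner≼ p) (inner≼ q) = inner≼ (≼-trans p q)
≼-trans (inner≼ p) ≼top       = ≼top
≼-trans bot≼       q          = bot≼
≼-trans ≼top       ≼top       = ≼top

≼-antisym : ∀ {w} {x y : El w} → x ≼ y → y ≼ x → x ≡ y
≼-antisym ε≼ε        ε≼ε        = refl
≼-antisym (inner≼ p) (inner≼ q) = cong inner (≼-antisym p q)
≼-antisym bot≼       bot≼       = cong (outer neg) (∋-irrelevant _ _)
≼-antisym ≼top       ≼top       = cong (outer pos) (∋-irrelevant _ _)

≼-total : ∀ {w} (x y : El w) → x ≼ y ⊎ y ≼ x
≼-total ε             ε             = inj₁ ε≼ε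
≼-total (inner x)     (inner y)     with ≼-total x y
... | inj₁ p = inj₁ (inner≼ p)
... | inj₂ q = inj₂ (inner≼ q)
≼-total _             (outer pos _) = inj₁ ≼top
≼-total _             (outer neg _) = inj₂ bot≼
≼-total (outer pos _) _             = inj₂ ≼top
≼-total (outer neg _) _             = inj₁ bot≼

⋆-assoc : ∀ {w} (x y z : El w) → (x ⋆ y) ⋆ z ≡ x ⋆ (y ⋆ z)
⋆-assoc ε           ε           ε           = refl
⋆-assoc (inner x)   (inner y)   (inner z)   = cong inner (⋆-assoc x y z)
⋆-assoc (inner _)   (inner _)   (outer _ _) = refl
⋆-assoc (inner _)   (outer _ _) (inner _)   = refl
⋆-assoc (outer _ _) (inner _)   (inner _)   = refl
⋆-assoc {single _     ∷ _} (inner _)   (outer _ _) (outer _ _) = refl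
⋆-assoc {double left  ∷ _} (inner _)   (outer _ _) (outer _ _) = refl
⋆-assoc {double right ∷ _} (inner _)   (outer _ _) (outer _ _) = refl
⋆-assoc (outer _ _) (inner _)   (outer _ _) = refl
⋆-assoc {single _     ∷ _} (outer _ _) (outer _ _) (inner _)   = refl
⋆-assoc {double left  ∷ _} (outer _ _) (outer _ _) (inner _)   = refl
⋆-assoc {double right ∷ _} (outer _ _) (outer _ _) (inner _)   = refl
⋆-assoc {single _     ∷ _} (outer _ _) (outer _ _) (outer _ _) = refl
⋆-assoc {double left  ∷ _} (outer _ _) (outer _ _) (outer _ _) = refl
⋆-assoc {double right ∷ _} (outer _ _) (outer _ _) (outer _ _) = refl

⋆-identityˡ : ∀ {w} (x : El w) → unit w ⋆ x ≡ x
⋆-identityˡ ε           = refl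
⋆-identityˡ (inner x)   = cong inner (⋆-identityˡ x)
⋆-identityˡ (outer _ _) = refl

⋆-identityʳ : ∀ {w} (x : El w) → x ⋆ unit w ≡ x
⋆-identityʳ ε           = refl
⋆-identityʳ (inner x)   = cong inner (⋆-identityʳ x)
⋆-identityʳ (outer _ _) = refl

⋆-idem : ∀ {w} (x : El w) → x ⋆ x ≡ x
⋆-idem ε         = refl
⋆-idem (inner x) = cong inner (⋆-idem x)
⋆-idem {single _     ∷ _} (outer _ _) = refl
⋆-idem {double left  ∷ _} (outer _ _) = refl
⋆-idem {double right ∷ _} (outer _ _) = refl

outer-⋆-single : ∀ {t w} s h (y : El (single t ∷ w)) → outer s h ⋆ y ≡ outer s h
outer-⋆-single s h (inner _)   = refl
outer-⋆-single s h (outer _ _) = refl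

outer-⋆-left : ∀ {w} s h (y : El (double left ∷ w)) → outer s h ⋆ y ≡ outer s h
outer-⋆-left s h (inner _)   = refl
outer-⋆-left s h (outer _ _) = refl

⋆-outer-right : ∀ {w} s h (y : El (double right ∷ w)) → y ⋆ outer s h ≡ outer s h
⋆-outer-right s h (inner _)   = refl
⋆-outer-right s h (outer _ _) = refl

⋆-monoˡ : ∀ {w} {x x′ : El w} y → x ≼ x′ → x ⋆ y ≼ x′ ⋆ y
⋆-monoˡ ε           ε≼ε        = ε≼ε
⋆-monoˡ (inner y)   (inner≼ p) = inner≼ (⋆-monoˡ y p)
⋆-monoˡ (outer _ _) (inner≼ p) = ≼-refl _
⋆-monoˡ (inner _)   bot≼       = bot≼
⋆-monoˡ (inner _)   ≼top       = ≼top
⋆-monoˡ {single _     ∷ _} (outer _ _) bot≼ = bot≼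
⋆-monoˡ {double left  ∷ _} (outer _ _) bot≼ = bot≼
⋆-monoˡ {single _     ∷ _} (outer _ _) ≼top = ≼top
⋆-monoˡ {double left  ∷ _} (outer _ _) ≼top = ≼top
-- Right multiplication by an outer element of a `double right` layer is constant.
⋆-monoˡ {double right ∷ _} {x} {x′} (outer s h) _
  rewrite ⋆-outer-right s h x | ⋆-outer-right s h x′ = ≼-refl _

⋆-monoʳ : ∀ {w} x {y y′ : El w} → y ≼ y′ → x ⋆ y ≼ x ⋆ y′
⋆-monoʳ ε           ε≼ε        = ε≼ε
⋆-monoʳ (inner x)   (inner≼ p) = inner≼ (⋆-monoʳ x p)
⋆-monoʳ (outer _ _) (inner≼ p) = ≼-refl _
⋆-monoʳ (inner _)   bot≼       = bot≼
⋆-monoʳ (inner _)   ≼top       = ≼top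
⋆-monoʳ {single _     ∷ _} (outer s h) {y} {y′} _
  rewrite outer-⋆-single s h y | outer-⋆-single s h y′ = ≼-refl _
⋆-monoʳ {double left  ∷ _} (outer s h) {y} {y′} _
  rewrite outer-⋆-left s h y | outer-⋆-left s h y′ = ≼-refl _
⋆-monoʳ {double right ∷ _} (outer _ _) bot≼ = bot≼
⋆-monoʳ {double right ∷ _} (outer _ _) ≼top = ≼top

width : Layer → ℕ
width (single _) = 1
width (double _) = 2

size : Word → ℕ
size []      = 0
size (l ∷ w) = width l + size w

point : ∀ s → single s ∋ s
point pos = +ₛ
point neg = -ₛ

-- The `suc` counts the unit, which belongs to no layer.
El-finite : ∀ w → El w ↔ Fin (suc (size w))
El-finite w = mk↔ₛ′ (index w) (element w) (index-element w) (element-index w)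
  where
  index : ∀ w → El w → Fin (suc (size w))
  index []             ε             = zero
  index (single _ ∷ w) (inner x)     = suc (index w x)
  index (single _ ∷ w) (outer _ _)   = zero
  index (double _ ∷ w) (inner x)     = suc (suc (index w x))
  index (double _ ∷ w) (outer pos _) = zero
  index (double _ ∷ w) (outer neg _) = suc zero

  element : ∀ w → Fin (suc (size w)) → El w
  element []             zero          = ε
  element (single s ∷ w) zero          = outer s (point s)
  element (single _ ∷ w) (suc i)       = inner (element w i)
  element (double _ ∷ w) zero          = outer pos both
  element (double _ ∷ w) (suc zero)    = outer neg both
  element (double _ ∷ w) (suc (suc i)) = inner (element w i)

  index-element : ∀ w i → index w (element w i) ≡ i
  index-element []             zero          = refl
  index-element (single _ ∷ w) zero          = refl
  index-element (single _ ∷ w) (suc i)       = cong suc (index-element w i)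
  index-element (double _ ∷ w) zero          = refl
  index-element (double _ ∷ w) (suc zero)    = refl
  index-element (double _ ∷ w) (suc (suc i)) = cong suc (cong suc (index-element w i))

  element-index : ∀ w x → element w (index w x) ≡ x
  element-index []             ε                = refl
  element-index (single _ ∷ w) (inner x)        = cong inner (element-index w x)
  element-index (single _ ∷ _) (outer pos +ₛ)   = refl
  element-index (single _ ∷ _) (outer neg -ₛ)   = refl
  element-index (double _ ∷ w) (inner x)        = cong inner (element-index w x)
  element-index (double _ ∷ _) (outer pos both) = refl
  element-index (double _ ∷ _) (outer neg both) = refl

model : Word → FiniteTomonoid
model w = record
  { Carrier      = El w
  ; _⊑_          = _≼_
  ; _∙_          = _⋆_
  ; e            = unit w
  ; isTotalOrder = record
    { isPartialOrder = record
      { isPreorder = record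
        { isEquivalence = isEquivalence
        ; reflexive     = λ { refl → ≼-refl _ }
        ; trans         = ≼-trans
        }
      ; antisym    = ≼-antisym
      }
    ; total          = ≼-total
    }
  ; isMonoid     = record
    { isSemigroup = record
      { isMagma = record { isEquivalence = isEquivalence ; ∙-cong = cong₂ _⋆_ }
      ; assoc   = ⋆-assoc
      }
    ; identity    = ⋆-identityˡ , ⋆-identityʳ
    }
  ; idem         = ⋆-idem
  ; mono         = λ {x} {x′} {y} {y′} p q → ≼-trans (⋆-monoˡ y p) (⋆-monoʳ x′ q)
  ; finite       = El-finite w
  }

-- Extracting layers from a tomonoid, from the unit outwards

_⊢_⊑[_]_ : (T : FiniteTomonoid) → let open FiniteTomonoid T in Carrier → Sign → Carrier → Set
T ⊢ x ⊑[ s ] y = FiniteTomonoid._⊑_ (orient s T) x y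

-- An isomorphism of model w onto an initial segment of T, of which every other
-- element of T is an absorber.
record Embedding (T : FiniteTomonoid) (w : Word) : Set where
  open FiniteTomonoid T
  field
    embed           : El w → Carrier
    embed-mono      : ∀ {x y} → x ≼ y → embed x ⊑ embed y
    embed-injective : ∀ {x y} → embed x ≡ embed y → x ≡ y
    embed-⋆         : ∀ x y → embed (x ⋆ y) ≡ embed x ∙ embed y
    embed-unit      : embed (unit w) ≡ e

  Outside : Carrier → Set
  Outside c = ∀ x → embed x ≢ c × c absorbs embed x

  field
    covers : ∀ c → (∃[ x ] embed x ≡ c) ⊎ Outside c

  outside? : ∀ c → Dec (Outside c)
  outside? c with covers c
  ... | inj₁ (x , eq) = no λ out → proj₁ (out x) eq
  ... | inj₂ out      = yes out

  Beyond : Sign → Carrier → Set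
  Beyond s c = Outside c × T ⊢ e ⊑[ s ] c

  -- In the order read away from `e`, the least outside element is the one nearest to `e` on its
  -- side, hence the candidate for the next layer.
  next : ∀ s → (∀ c → ¬ Beyond s c) ⊎
               ∃[ m ] Beyond s m × (∀ c → Beyond s c → T ⊢ m ⊑[ s ] c)
  next s = Tₛ.least λ c → outside? c ×-dec (e Tₛ.⊑? c)
    where module Tₛ = FiniteTomonoid (orient s T)

  beyond-or-beyond : ∀ s {c} → Outside c → Beyond s c ⊎ Beyond (opposite s) c
  beyond-or-beyond s {c} out with s | total e c
  ... | pos | inj₁ p = inj₁ (out , p)
  ... | pos | inj₂ p = inj₂ (out , p)
  ... | neg | inj₁ p = inj₂ (out , p)
  ... | neg | inj₂ p = inj₁ (out , p)

  beyond-absorbs : ∀ s {m c} → Beyond s m → T ⊢ m ⊑[ s ] c → c absorbs m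
  beyond-absorbs s (_ , e⊑m) m⊑c = above-absorbs (orient s T) e⊑m m⊑c

  -- A common element would lie both above and below `e`, hence be `e`, which `embed` already
  -- reaches.
  beyond-both : ∀ s {c d} → Beyond s c → Beyond (opposite s) d → c ≢ d
  beyond-both s {c} (out , p) (_ , q) refl = proj₁ (out (unit w)) (trans embed-unit (e≡c s p q))
    where
    e≡c : ∀ s → T ⊢ e ⊑[ s ] c → T ⊢ e ⊑[ opposite s ] c → e ≡ c
    e≡c pos p q = antisym p q
    e≡c neg p q = antisym q p

  -- The two alternatives are mirror images under `op`. A single one-sided product of `p` and `n`
  -- thus decides absorption of `n` by everything strictly beyond `p`.
  beyond-opposite-absorbs : ∀ s {p n c} → Beyond s p → Beyond (opposite s) n →
                            T ⊢ p ⊑[ s ] c → p ≢ c → p ∙ n ≡ p ⊎ n ∙ p ≡ p → c absorbs n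
  beyond-opposite-absorbs s {p} {n} {c} P@(_ , e⊑p) N@(_ , n⊑e) p⊑c p≢c = λ
    { (inj₁ eq) → cross-absorbs (orient s T) e⊑p p⊑c (below s n⊑e) n≢p p≢c eq
    ; (inj₂ eq) → swap (cross-absorbs (op (orient s T)) e⊑p p⊑c (below s n⊑e) n≢p p≢c eq)
    }
    where
    n≢p : n ≢ p
    n≢p n≡p = beyond-both s P N (sym n≡p)
    below : ∀ s → T ⊢ e ⊑[ opposite s ] n → T ⊢ n ⊑[ s ] e
    below pos q = q
    below neg q = q

  -- Shared by all kinds of layers. Outside elements absorb the image of `embed`, so only the
  -- products within the new layer have to be prescribed, by `g-merge`; `g-covers` restores the
  -- invariant that whatever is still outside absorbs everything inside.
  extend : ∀ l (g : ∀ {s} → l ∋ s → Carrier) → (∀ {s} (h : l ∋ s) → Beyond s (g h)) →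
           (∀ {s t} (h : l ∋ s) (k : l ∋ t) → g h ∙ g k ≡ merge l (g h) (g k)) →
           (∀ c → Outside c → (∃[ s ] Σ[ h ∈ l ∋ s ] g h ≡ c) ⊎
                              (∀ {s} (h : l ∋ s) → g h ≢ c × c absorbs g h)) →
           Embedding T (l ∷ w)
  extend l g beyond g-merge g-covers = record
    { embed           = f
    ; embed-mono      = f-mono
    ; embed-injective = f-injective
    ; embed-⋆         = f-⋆
    ; embed-unit      = embed-unit
    ; covers          = f-covers
    }
    where
    f : El (l ∷ w) → Carrier
    f (inner x)   = embed x
    f (outer s h) = g h

    e⊑top : (h : l ∋ pos) → e ⊑ g h
    e⊑top h = proj₂ (beyond h)

    bot⊑e : (h : l ∋ neg) → g h ⊑ e
    bot⊑e h = proj₂ (beyond h)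

    inner⊑top : (h : l ∋ pos) → ∀ x → embed x ⊑ g h
    inner⊑top h x with total e (embed x)
    ... | inj₂ x⊑e = ⊑-trans x⊑e (e⊑top h)
    -- Absorption turns `e ∙ embed x ⊑ g h ∙ embed x` into `embed x ⊑ g h`.
    ... | inj₁ e⊑x = subst₂ _⊑_ (identityˡ _) (proj₁ (proj₂ (proj₁ (beyond h) x)))
                       (mono (e⊑top h) ⊑-refl)

    bot⊑inner : (h : l ∋ neg) → ∀ x → g h ⊑ embed x
    bot⊑inner h x with total e (embed x)
    ... | inj₁ e⊑x = ⊑-trans (bot⊑e h) e⊑x
    ... | inj₂ x⊑e = subst₂ _⊑_ (proj₁ (proj₂ (proj₁ (beyond h) x))) (identityˡ _)
                       (mono (bot⊑e h) ⊑-refl)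

    f-mono : ∀ {x y} → x ≼ y → f x ⊑ f y
    f-mono (inner≼ p) = embed-mono p
    f-mono (bot≼ {h = h} {inner y})     = bot⊑inner h y
    f-mono (bot≼ {h = h} {outer pos k}) = ⊑-trans (bot⊑e h) (e⊑top k)
    f-mono (bot≼ {h = h} {outer neg k}) = ⊑-reflexive (cong g (∋-irrelevant h k))
    f-mono (≼top {h = h} {inner x})     = inner⊑top h x
    f-mono (≼top {h = h} {outer pos k}) = ⊑-reflexive (cong g (∋-irrelevant k h))
    f-mono (≼top {h = h} {outer neg k}) = ⊑-trans (bot⊑e k) (e⊑top h)

    f-injective : ∀ {x y} → f x ≡ f y → x ≡ y
    f-injective {inner x}     {inner y}     eq = cong inner (embed-injective eq)
    f-injective {inner x}     {outer s h}   eq = contradiction eq (proj₁ (proj₁ (beyond h) x))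
    f-injective {outer s h}   {inner y}     eq = contradiction (sym eq) (proj₁ (proj₁ (beyond h) y))
    f-injective {outer pos h} {outer pos k} eq = cong (outer pos) (∋-irrelevant h k)
    f-injective {outer neg h} {outer neg k} eq = cong (outer neg) (∋-irrelevant h k)
    f-injective {outer pos h} {outer neg k} eq =
      contradiction eq (beyond-both pos (beyond h) (beyond k))
    f-injective {outer neg h} {outer pos k} eq =
      contradiction eq (beyond-both neg (beyond h) (beyond k))

    f-merge : ∀ l′ {x y} → f (merge l′ x y) ≡ merge l′ (f x) (f y)
    f-merge (single _)     = refl
    f-merge (double left)  = refl
    f-merge (double right) = refl

    f-⋆ : ∀ x y → f (x ⋆ y) ≡ f x ∙ f y
    f-⋆ (inner x)   (inner y)   = embed-⋆ x y
    f-⋆ (inner x)   (outer _ k) = sym (proj₂ (proj₂ (proj₁ (beyond k) x)))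
    f-⋆ (outer _ h) (inner y)   = sym (proj₁ (proj₂ (proj₁ (beyond h) y)))
    f-⋆ (outer _ h) (outer _ k) = trans (f-merge l) (sym (g-merge h k))

    f-covers : ∀ c → (∃[ x ] f x ≡ c) ⊎ (∀ x → f x ≢ c × c absorbs f x)
    f-covers c with covers c
    ... | inj₁ (x , eq) = inj₁ (inner x , eq)
    ... | inj₂ out with g-covers c out
    ...   | inj₁ (s , h , eq) = inj₁ (outer s h , eq)
    ...   | inj₂ out′         = inj₂ λ { (inner x) → out x ; (outer _ h) → out′ h }

  extend-single : ∀ s m → Beyond s m → (∀ c → Beyond s c → T ⊢ m ⊑[ s ] c) →
                  (∀ c → Beyond (opposite s) c → c absorbs m) → Embedding T (single s ∷ w)
  extend-single s m M min opp = extend (single s) (λ _ → m)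
    (λ { +ₛ → M ; -ₛ → M }) (λ _ _ → idem m) m-covers
    where
    m-covers : ∀ c → Outside c → (∃[ t ] Σ[ h ∈ single s ∋ t ] m ≡ c) ⊎
                                 (∀ {t} (h : single s ∋ t) → m ≢ c × c absorbs m)
    m-covers c out with m ≟ c | beyond-or-beyond s out
    ... | yes m≡c | _      = inj₁ (s , point s , m≡c)
    ... | no  m≢c | inj₁ C = inj₂ λ _ → m≢c , beyond-absorbs s M (min c C)
    ... | no  m≢c | inj₂ C = inj₂ λ _ → m≢c , opp c C

  -- By `pn` and `np` each of `p` and `n` wins in one order of multiplication, so an element
  -- strictly beyond either of them absorbs both.
  extend-double : ∀ d p n → Beyond pos p → (∀ c → Beyond pos c → p ⊑ c) →
                  Beyond neg n → (∀ c → Beyond neg c → c ⊑ n) →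
                  p ∙ n ≡ merge (double d) p n → n ∙ p ≡ merge (double d) n p →
                  Embedding T (double d ∷ w)
  extend-double d p n P p-min N n-min pn np = extend (double d) g
    (λ { {pos} _ → P ; {neg} _ → N }) g-merge g-covers
    where
    g : ∀ {s} → double d ∋ s → Carrier
    g {pos} _ = p
    g {neg} _ = n

    merge-idem : ∀ d x → x ∙ x ≡ merge (double d) x x
    merge-idem left  = idem
    merge-idem right = idem

    g-merge : ∀ {s t} (h : double d ∋ s) (k : double d ∋ t) →
              g h ∙ g k ≡ merge (double d) (g h) (g k)
    g-merge {pos} {pos} _ _ = merge-idem d p
    g-merge {neg} {neg} _ _ = merge-idem d n
    g-merge {pos} {neg} _ _ = pn
    g-merge {neg} {pos} _ _ = np

    p-side : ∀ d → p ∙ n ≡ merge (double d) p n → n ∙ p ≡ merge (double d) n p →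
             p ∙ n ≡ p ⊎ n ∙ p ≡ p
    p-side left  eq _ = inj₁ eq
    p-side right _ eq = inj₂ eq

    n-side : ∀ d → p ∙ n ≡ merge (double d) p n → n ∙ p ≡ merge (double d) n p →
             n ∙ p ≡ n ⊎ p ∙ n ≡ n
    n-side left  _ eq = inj₁ eq
    n-side right eq _ = inj₂ eq

    g-covers : ∀ c → Outside c → (∃[ s ] Σ[ h ∈ double d ∋ s ] g h ≡ c) ⊎
                                 (∀ {s} (h : double d ∋ s) → g h ≢ c × c absorbs g h)
    g-covers c out with p ≟ c | n ≟ c | beyond-or-beyond pos out
    ... | yes p≡c | _       | _      = inj₁ (pos , both , p≡c)
    ... | no  _   | yes n≡c | _      = inj₁ (neg , both , n≡c)
    ... | no  p≢c | no  n≢c | inj₁ C = inj₂ λ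
      { {pos} _ → p≢c , beyond-absorbs pos P (p-min c C)
      ; {neg} _ → n≢c , beyond-opposite-absorbs pos P N (p-min c C) p≢c (p-side d pn np)
      }
    ... | no  p≢c | no  n≢c | inj₂ C = inj₂ λ
      { {pos} _ → p≢c , beyond-opposite-absorbs neg N P (n-min c C) n≢c (n-side d pn np)
      ; {neg} _ → n≢c , beyond-absorbs neg N (n-min c C)
      }

  -- Since `o` absorbs `m`, the element `m` forms a layer of its own and `o` is left for later.
  -- Elements beyond `o` absorb `m` as well.
  extend-absorbed : ∀ s m o → Beyond s m → (∀ c → Beyond s c → T ⊢ m ⊑[ s ] c) →
                    Beyond (opposite s) o →
                    (∀ c → Beyond (opposite s) c → T ⊢ o ⊑[ opposite s ] c) →
                    o absorbs m → Embedding T (single s ∷ w)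
  extend-absorbed s m o M m-min O o-min om = extend-single s m M m-min opp
    where
    opp : ∀ c → Beyond (opposite s) c → c absorbs m
    opp c C with o ≟ c
    ... | yes refl = om
    ... | no  o≢c  =
      beyond-opposite-absorbs (opposite s) O
        -- Seen from the side of `o`, the sign of `m` is `opposite (opposite s)`.
        (subst (λ t → Beyond t m) (sym (opposite-selfInverse {s} refl)) M)
        (o-min c C) o≢c (inj₁ (proj₁ om))

  -- When there are nearest outside elements `p` above and `n` below `e`, conservativity leaves four
  -- cases for `p ∙ n` and `n ∙ p`. If both are the left factor or both the right factor, the layer
  -- is double; otherwise one element absorbs the other, and the absorbed one becomes a single
  -- layer.
  extend-or-surjective : (∃[ l ] Embedding T (l ∷ w)) ⊎ (∀ c → ∃[ x ] embed x ≡ c)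
  extend-or-surjective with next pos | next neg
  ... | inj₁ no-pos | inj₁ no-neg = inj₂ surjective
    where
    surjective : ∀ c → ∃[ x ] embed x ≡ c
    surjective c with covers c
    ... | inj₁ c∈w = c∈w
    ... | inj₂ out with beyond-or-beyond pos out
    ...   | inj₁ C = contradiction C (no-pos c)
    ...   | inj₂ C = contradiction C (no-neg c)
  ... | inj₁ no-pos | inj₂ (n , N , n-min) =
    inj₁ (_ , extend-single neg n N n-min λ c C → contradiction C (no-pos c))
  ... | inj₂ (p , P , p-min) | inj₁ no-neg =
    inj₁ (_ , extend-single pos p P p-min λ c C → contradiction C (no-neg c))
  ... | inj₂ (p , P , p-min) | inj₂ (n , N , n-min)
    with conservative T p n | conservative T n p
  ...   | inj₁ pn | inj₁ np = inj₁ (_ , extend-double left  p n P p-min N n-min pn np)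
  ...   | inj₂ pn | inj₂ np = inj₁ (_ , extend-double right p n P p-min N n-min pn np)
  ...   | inj₁ pn | inj₂ np = inj₁ (_ , extend-absorbed neg n p N n-min P p-min (pn , np))
  ...   | inj₂ pn | inj₁ np = inj₁ (_ , extend-absorbed pos p n P p-min N n-min (np , pn))

-- Isomorphisms of tomonoids, and existence of the word

infix 4 _≃_
record _≃_ (S T : FiniteTomonoid) : Set where
  private
    module S = FiniteTomonoid S
    module T = FiniteTomonoid T
  field
    iso : S.Carrier ↔ T.Carrier
  open Inverse iso public using (to; from; strictlyInverseˡ; strictlyInverseʳ)
  field
    to-mono : ∀ {x y} → x S.⊑ y → to x T.⊑ to y
    to-∙    : ∀ x y → to (x S.∙ y) ≡ to x T.∙ to y

  to-injective : ∀ {x y} → to x ≡ to y → x ≡ y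
  to-injective {x} {y} eq =
    trans (sym (strictlyInverseʳ x)) (trans (cong from eq) (strictlyInverseʳ y))

  -- By totality the only other case is `from y ⊑ from x`, which gives `y ⊑ x` and so `x ≡ y`.
  from-mono : ∀ {x y} → x T.⊑ y → from x S.⊑ from y
  from-mono {x} {y} x⊑y with S.total (from x) (from y)
  ... | inj₁ p = p
  ... | inj₂ q = S.⊑-reflexive (cong from (T.antisym x⊑y
          (subst₂ T._⊑_ (strictlyInverseˡ y) (strictlyInverseˡ x) (to-mono q))))

  from-∙ : ∀ x y → from (x T.∙ y) ≡ from x S.∙ from y
  from-∙ x y = to-injective (begin
    to (from (x T.∙ y))        ≡⟨ strictlyInverseˡ _ ⟩
    x T.∙ y                    ≡⟨ cong₂ T._∙_ (strictlyInverseˡ x) (strictlyInverseˡ y) ⟨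
    to (from x) T.∙ to (from y) ≡⟨ to-∙ (from x) (from y) ⟨
    to (from x S.∙ from y)     ∎)
    where open ≡-Reasoning

  -- The element `to S.e` is a left unit on the image of `to`, which contains `T.e`.
  to-e : to S.e ≡ T.e
  to-e = begin
    to S.e                     ≡⟨ T.identityʳ _ ⟨
    to S.e T.∙ T.e             ≡⟨ cong (to S.e T.∙_) (strictlyInverseˡ T.e) ⟨
    to S.e T.∙ to (from T.e)   ≡⟨ to-∙ S.e (from T.e) ⟨
    to (S.e S.∙ from T.e)      ≡⟨ cong to (S.identityˡ _) ⟩
    to (from T.e)              ≡⟨ strictlyInverseˡ T.e ⟩
    T.e                        ∎
    where open ≡-Reasoning

≃-sym : ∀ {S T} → S ≃ T → T ≃ S
≃-sym i = record { iso = ↔-sym iso ; to-mono = from-mono ; to-∙ = from-∙ }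
  where open _≃_ i

≃-trans : ∀ {S T U} → S ≃ T → T ≃ U → S ≃ U
≃-trans i j = record
  { iso     = ↔-trans I.iso J.iso
  ; to-mono = λ x⊑y → J.to-mono (I.to-mono x⊑y)
  ; to-∙    = λ x y → trans (cong J.to (I.to-∙ x y)) (J.to-∙ _ _)
  }
  where
  module I = _≃_ i
  module J = _≃_ j

-- Starting from the unit alone, layers are added until the embedding is onto. Each layer increases
-- `size w`, which stays below `order`, so the fuel `k` with `order ≤ size w + k` cannot run out.
≃-model : ∀ T → ∃[ w ] model w ≃ T
≃-model T = grow order trivial ≤-refl
  where
  open FiniteTomonoid T

  trivial : Embedding T []
  trivial = record
    { embed           = λ _ → e
    ; embed-mono      = λ _ → ⊑-refl
    ; embed-injective = λ { {ε} {ε} _ → refl }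
    ; embed-⋆         = λ _ _ → sym (identityˡ e)
    ; embed-unit      = refl
    ; covers          = e-covers
    }
    where
    e-covers : ∀ c → (∃[ x ] e ≡ c) ⊎ (∀ (x : El []) → e ≢ c × c absorbs e)
    e-covers c with e ≟ c
    ... | yes e≡c = inj₁ (ε , e≡c)
    ... | no  e≢c = inj₂ λ _ → e≢c , identityʳ c , identityˡ c

  size< : ∀ {w} → Embedding T w → size w < order
  size< {w} E = injective⇒≤ {f = Inverse.to finite ∘ embed ∘ Inverse.from (El-finite w)} λ eq →
    Injection.injective (↔⇒↣ (↔-sym (El-finite w)))
      (embed-injective (Injection.injective (↔⇒↣ finite) eq))
    where open Embedding E

  grow : ∀ k {w} → Embedding T w → order ≤ size w + k → ∃[ w′ ] model w′ ≃ T
  grow zero {w} E N≤ =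
    contradiction (≤-trans (size< E) (subst (order ≤_) (+-identityʳ (size w)) N≤)) (n≮n (size w))
  grow (suc k) {w} E N≤ with Embedding.extend-or-surjective E
  ... | inj₁ (l , E′) = grow k E′
    (≤-trans N≤ (≤-trans (≤-reflexive (+-suc (size w) k)) (+-monoˡ-≤ k (size-< l))))
    where
    size-< : ∀ l → size w < width l + size w
    size-< (single _) = n<1+n _
    size-< (double _) = m<n⇒m<1+n (n<1+n _)
  ... | inj₂ surj = w , record
    { iso     = mk↔ₛ′ embed (proj₁ ∘ surj) (proj₂ ∘ surj)
                  (λ x → embed-injective (proj₂ (surj (embed x))))
    ; to-mono = embed-mono
    ; to-∙    = embed-⋆
    }
    where open Embedding E

-- Uniqueness of the word

-- For a nonempty word this describes the outermost layer by products alone, so isomorphisms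
-- preserve it: an outer element survives every product in at least one order, while an inner one is
-- lost in both products with an outer one.
IsOuter : ∀ {w} → El w → Set
IsOuter x = ∀ y → x ⋆ y ≡ x ⊎ y ⋆ x ≡ x

outer-isOuter : ∀ {l w s h} → IsOuter {l ∷ w} (outer s h)
outer-isOuter {single _}     {s = s} {h} y = inj₁ (outer-⋆-single s h y)
outer-isOuter {double left}  {s = s} {h} y = inj₁ (outer-⋆-left s h y)
outer-isOuter {double right} {s = s} {h} y = inj₂ (⋆-outer-right s h y)

inhabited : ∀ l → ∃[ s ] l ∋ s
inhabited (single s) = s , point s
inhabited (double _) = pos , both

inner-¬isOuter : ∀ {l w} {x : El w} → ¬ IsOuter {l ∷ w} (inner x)
inner-¬isOuter {l} x-outer with inhabited l
... | s , h with x-outer (outer s h)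
...   | inj₁ ()
...   | inj₂ ()

module _ {v w} (i : model v ≃ model w) where
  open _≃_ i

  ≃-isOuter : ∀ {x} → IsOuter x → IsOuter (to x)
  ≃-isOuter {x} x-outer y
    rewrite sym (strictlyInverseˡ y) | sym (to-∙ x (from y)) | sym (to-∙ (from y) x)
    with x-outer (from y)
  ... | inj₁ eq = inj₁ (cong to eq)
  ... | inj₂ eq = inj₂ (cong to eq)

≃-inner : ∀ {k l v w} (i : model (k ∷ v) ≃ model (l ∷ w)) →
          ∀ x → ∃[ y ] _≃_.to i (inner x) ≡ inner y
≃-inner i x with _≃_.to i (inner x) in eq
... | inner y   = y , refl
... | outer s h = contradiction
        (subst IsOuter (trans (cong from (sym eq)) (strictlyInverseʳ (inner x)))
          (≃-isOuter (≃-sym i) outer-isOuter))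
        inner-¬isOuter
  where open _≃_ i

-- `IsOuter` keeps the image in the outermost layer; preservation of the order and the unit keeps it
-- on the same side.
≃-outer : ∀ {k l v w} (i : model (k ∷ v) ≃ model (l ∷ w)) →
          ∀ {s} (h : k ∋ s) → Σ[ h′ ∈ l ∋ s ] _≃_.to i (outer s h) ≡ outer s h′
≃-outer {k} {l} {v} {w} i {s} h = outer-image s (to (outer s h)) (above s)
    (≃-isOuter i outer-isOuter)
  where
  open _≃_ i
  above : ∀ s {h : k ∋ s} → model (l ∷ w) ⊢ unit (l ∷ w) ⊑[ s ] to (outer s h)
  above pos {h} = subst (_≼ to (outer pos h)) to-e (to-mono ≼top)
  above neg {h} = subst (to (outer neg h) ≼_) to-e (to-mono bot≼)
  outer-image : ∀ s (z : El (l ∷ w)) → model (l ∷ w) ⊢ unit (l ∷ w) ⊑[ s ] z → IsOuter z →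
                Σ[ h ∈ l ∋ s ] z ≡ outer s h
  outer-image _   (inner _)     _ z-outer = contradiction z-outer inner-¬isOuter
  outer-image pos (outer pos h) _ _ = h , refl
  outer-image neg (outer neg h) _ _ = h , refl

≃-tail : ∀ {k l v w} → model (k ∷ v) ≃ model (l ∷ w) → model v ≃ model w
≃-tail {k} {l} {v} {w} i = record
  { iso     = mk↔ₛ′ f g
      (λ y → inner-injective (begin
        inner (f (g y))          ≡⟨ proj₂ (≃-inner i (g y)) ⟨
        to (inner (g y))         ≡⟨ cong to (proj₂ (≃-inner (≃-sym i) y)) ⟨
        to (from (inner y))      ≡⟨ strictlyInverseˡ _ ⟩
        inner y                  ∎))
      (λ x → inner-injective (begin
        inner (g (f x))          ≡⟨ proj₂ (≃-inner (≃-sym i) (f x)) ⟨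
        from (inner (f x))       ≡⟨ cong from (proj₂ (≃-inner i x)) ⟨
        from (to (inner x))      ≡⟨ strictlyInverseʳ _ ⟩
        inner x                  ∎))
  ; to-mono = λ {x} {y} x≼y → inner-reflects
      (subst₂ _≼_ (proj₂ (≃-inner i x)) (proj₂ (≃-inner i y)) (to-mono (inner≼ x≼y)))
  ; to-∙    = λ x y → inner-injective (begin
        inner (f (x ⋆ y))            ≡⟨ proj₂ (≃-inner i (x ⋆ y)) ⟨
        to (inner x ⋆ inner y)       ≡⟨ to-∙ (inner x) (inner y) ⟩
        to (inner x) ⋆ to (inner y)  ≡⟨ cong₂ _⋆_ (proj₂ (≃-inner i x)) (proj₂ (≃-inner i y)) ⟩
        inner (f x ⋆ f y)            ∎)
  }
  where
  open _≃_ i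
  open ≡-Reasoning
  f : El v → El w
  f x = proj₁ (≃-inner i x)
  g : El w → El v
  g y = proj₁ (≃-inner (≃-sym i) y)
  inner-injective : ∀ {l w} {x y : El w} → inner {l} x ≡ inner y → x ≡ y
  inner-injective refl = refl
  inner-reflects : ∀ {l w} {x y : El w} → inner {l} x ≼ inner y → x ≼ y
  inner-reflects (inner≼ p) = p

-- By `≃-outer` the two layers have elements of the same signs. For two double layers, the image of
-- the product of top and bottom reveals the side.
≃-head : ∀ {k l v w} → model (k ∷ v) ≃ model (l ∷ w) → k ≡ l
≃-head {single s} {single t} i with proj₁ (≃-outer i (point s))
... | +ₛ = refl
... | -ₛ = refl
≃-head {single s} {double d} i
  with proj₁ (≃-outer (≃-sym i) {pos} both) | proj₁ (≃-outer (≃-sym i) {neg} both)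
... | +ₛ | ()
≃-head {double c} {single t} i with proj₁ (≃-outer i {pos} both) | proj₁ (≃-outer i {neg} both)
... | +ₛ | ()
≃-head {double c} {double d} i with ≃-outer i {pos} both | ≃-outer i {neg} both
... | both , top-eq | both , bot-eq = cong double (same-side c d
    (trans (to-∙ (outer pos both) (outer neg both)) (cong₂ _⋆_ top-eq bot-eq)))
  where
  open _≃_ i
  same-side : ∀ c d → to (merge (double c) (outer pos both) (outer neg both)) ≡
                      merge (double d) (outer pos both) (outer neg both) → c ≡ d
  same-side left  left  _  = refl
  same-side right right _  = refl
  same-side left  right eq = contradiction (trans (sym top-eq) eq) λ ()
  same-side right left  eq = contradiction (trans (sym bot-eq) eq) λ ()

≃⇒≡ : ∀ {v w} → model v ≃ model w → v ≡ w
≃⇒≡ {[]}    {[]}    _ = refl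
≃⇒≡ {[]}    {l ∷ w} i with inhabited l
-- `El []` has one element, too few for both the unit and an outer element.
... | s , h with _≃_.to-injective (≃-sym i) {inner (unit w)} {outer s h} (all-equal _ _)
  where
  all-equal : (x y : El []) → x ≡ y
  all-equal ε ε = refl
...   | ()
≃⇒≡ {k ∷ v} {[]}    i = sym (≃⇒≡ (≃-sym i))
≃⇒≡ {k ∷ v} {l ∷ w} i = cong₂ _∷_ (≃-head i) (≃⇒≡ (≃-tail i))

-- Residuated chains as tomonoids

module ChainOrder {A : ResiduatedLattice} (chain : IsIdempotentResiduatedChain A) where
  open ResiduatedLattice A
    renaming (_≤_ to _⊑_; _·_ to _∙_)
  open IsLattice isLattice using (∧-comm; ∧-assoc; ∨-comm; ∨-absorbs-∧)
  open IsIdempotentResiduatedChain chain public using (total; idempotent)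
  open Equivalence using (to; from)

  ⊑-refl : ∀ {x} → x ⊑ x
  ⊑-refl {x} with total x x
  ... | inj₁ p = p
  ... | inj₂ p = p

  ⊑-trans : ∀ {x y z} → x ⊑ y → y ⊑ z → x ⊑ z
  ⊑-trans {x} {y} {z} x⊑y y⊑z = begin
    x ∧ z       ≡⟨ cong (_∧ z) x⊑y ⟨
    (x ∧ y) ∧ z ≡⟨ ∧-assoc x y z ⟩
    x ∧ y ∧ z   ≡⟨ cong (x ∧_) y⊑z ⟩
    x ∧ y       ≡⟨ x⊑y ⟩
    x           ∎
    where open ≡-Reasoning

  ⊑-antisym : ∀ {x y} → x ⊑ y → y ⊑ x → x ≡ y
  ⊑-antisym {x} {y} x⊑y y⊑x = trans (sym x⊑y) (trans (∧-comm x y) y⊑x)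

  ⊑⇒∨ : ∀ {x y} → x ⊑ y → x ∨ y ≡ y
  ⊑⇒∨ {x} {y} x⊑y = begin
    x ∨ y       ≡⟨ ∨-comm x y ⟩
    y ∨ x       ≡⟨ cong (y ∨_) (trans (∧-comm y x) x⊑y) ⟨
    y ∨ (y ∧ x) ≡⟨ ∨-absorbs-∧ y x ⟩
    y           ∎
    where open ≡-Reasoning

  -- Residuation gives `x ⊑ x′ ⊑ (x′ ∙ y) // y`, hence `x ∙ y ⊑ x′ ∙ y`; the other residual handles
  -- the second factor.
  ∙-mono : ∀ {x x′ y y′} → x ⊑ x′ → y ⊑ y′ → x ∙ y ⊑ x′ ∙ y′
  ∙-mono {x} {x′} {y} {y′} x⊑x′ y⊑y′ = ⊑-trans
    (from (residual-// x y (x′ ∙ y)) (⊑-trans x⊑x′ (to (residual-// x′ y (x′ ∙ y)) ⊑-refl)))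
    (to (residual-\\ x′ y (x′ ∙ y′)) (⊑-trans y⊑y′ (from (residual-\\ x′ y′ (x′ ∙ y′)) ⊑-refl)))

  tomonoid : ∀ {n} → Carrier ↔ Fin n → FiniteTomonoid
  tomonoid finite = record
    { _⊑_          = _⊑_
    ; isTotalOrder = record
      { isPartialOrder = record
        { isPreorder = record
          { isEquivalence = isEquivalence
          ; reflexive     = λ { refl → ⊑-refl }
          ; trans         = ⊑-trans
          }
        ; antisym    = ⊑-antisym
        }
      ; total          = total
      }
    ; isMonoid     = isMonoid
    ; idem         = idempotent
    ; mono         = ∙-mono
    ; finite       = finite
    }

  -- Minimality gives `⊥ ⊑ ⊥ // x`, which residuation turns into `⊥ ∙ x ⊑ ⊥`; the other product is
  -- symmetric.
  bottom-zero : ∀ {⊥} → (∀ x → ⊥ ⊑ x) → ∀ x → ⊥ ∙ x ≡ ⊥ × x ∙ ⊥ ≡ ⊥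
  bottom-zero {⊥} ⊥-min x =
    ⊑-antisym (from (residual-// ⊥ x ⊥) (⊥-min (⊥ // x))) (⊥-min (⊥ ∙ x)) ,
    ⊑-antisym (to (residual-\\ x ⊥ ⊥) (⊥-min (x \\ ⊥))) (⊥-min (x ∙ ⊥))

-- An isomorphism of the ordered monoids preserves the residuals and the lattice
-- operations, as these are determined by order and product.
module _ {A B : ResiduatedLattice}
         (cA : IsIdempotentResiduatedChain A) (cB : IsIdempotentResiduatedChain B) where
  private
    module A = ResiduatedLattice A
    module B = ResiduatedLattice B
    module CA = ChainOrder cA
    module CB = ChainOrder cB

  ≃⇒≅ : ∀ {m n} {a : A.Carrier ↔ Fin m} {b : B.Carrier ↔ Fin n} →
        CA.tomonoid a ≃ CB.tomonoid b → A ≅ B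
  ≃⇒≅ i = record
    { bijection = iso
    ; ∧-homo    = to-∧
    ; ∨-homo    = to-∨
    ; ·-homo    = to-∙
    ; \\-homo   = λ x y → CB.⊑-antisym
        (E.from (B.residual-\\ _ _ _) (subst (B._≤ to y) (to-∙ x (x A.\\ y))
          (to-mono (E.to (A.residual-\\ _ _ _) CA.⊑-refl))))
        (subst (B._≤ to (x A.\\ y)) (strictlyInverseˡ _)
          (to-mono (E.from (A.residual-\\ _ _ _) (to-reflects
            (subst (B._≤ to y)
              (trans (cong (to x B.·_) (sym (strictlyInverseˡ _))) (sym (to-∙ x _)))
              (E.to (B.residual-\\ _ _ _) CB.⊑-refl))))))
    ; //-homo   = λ x y → CB.⊑-antisym
        (E.to (B.residual-// _ _ _) (subst (B._≤ to x) (to-∙ (x A.// y) y)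
          (to-mono (E.from (A.residual-// _ _ _) CA.⊑-refl))))
        (subst (B._≤ to (x A.// y)) (strictlyInverseˡ _)
          (to-mono (E.to (A.residual-// _ _ _) (to-reflects
            (subst (B._≤ to x)
              (trans (cong (B._· to y) (sym (strictlyInverseˡ _))) (sym (to-∙ _ y)))
              (E.from (B.residual-// _ _ _) CB.⊑-refl))))))
    ; e-homo    = to-e
    }
    where
    open _≃_ i
    module E = Equivalence
    module AL = IsLattice A.isLattice
    module BL = IsLattice B.isLattice

    to-reflects : ∀ {x y} → to x B.≤ to y → x A.≤ y
    to-reflects p = subst₂ A._≤_ (strictlyInverseʳ _) (strictlyInverseʳ _) (from-mono p)

    to-∧ : ∀ x y → to (x A.∧ y) ≡ to x B.∧ to y
    to-∧ x y with CA.total x y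
    ... | inj₁ x⊑y = trans (cong to x⊑y) (sym (to-mono x⊑y))
    ... | inj₂ y⊑x = trans (cong to (trans (AL.∧-comm x y) y⊑x))
                       (sym (trans (BL.∧-comm (to x) (to y)) (to-mono y⊑x)))

    to-∨ : ∀ x y → to (x A.∨ y) ≡ to x B.∨ to y
    to-∨ x y with CA.total x y
    ... | inj₁ x⊑y = trans (cong to (CA.⊑⇒∨ x⊑y)) (sym (CB.⊑⇒∨ (to-mono x⊑y)))
    ... | inj₂ y⊑x = trans (cong to (trans (AL.∨-comm x y) (CA.⊑⇒∨ y⊑x)))
                       (sym (trans (BL.∨-comm (to x) (to y)) (CB.⊑⇒∨ (to-mono y⊑x))))

  ≅⇒≃ : ∀ {m n} (a : A.Carrier ↔ Fin m) (b : B.Carrier ↔ Fin n) →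
        A ≅ B → CA.tomonoid a ≃ CB.tomonoid b
  ≅⇒≃ _ _ i = record
    { iso     = bijection
    ; to-mono = λ {x} {y} x⊑y → trans (sym (∧-homo x y)) (cong to x⊑y)
    ; to-∙    = ·-homo
    }
    where open _≅_ i

-- Residuals from an absorbing least element

module Residuation
  (T : FiniteTomonoid) (⊥ : FiniteTomonoid.Carrier T)
  (⊥-min : ∀ x → FiniteTomonoid._⊑_ T ⊥ x)
  (⊥-zero : ∀ x → FiniteTomonoid._∙_ T ⊥ x ≡ ⊥ × FiniteTomonoid._∙_ T x ⊥ ≡ ⊥) where
  open FiniteTomonoid T

  private
    O : TotalOrder _ _ _
    O = record { isTotalOrder = isTotalOrder }
    open Min O using (_⊓_; minOperator; x≤y⇒x⊓y≈x)
    open Max O using (_⊔_; maxOperator)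
    open MinOp minOperator using (x⊓y≈x⇒x≤y)

    greatest : {P : Carrier → Set} → (∀ x → Dec (P x)) → P ⊥ →
               ∃[ m ] P m × (∀ x → P x → x ⊑ m)
    greatest P? p with FiniteTomonoid.least (orient neg T) P?
    ... | inj₁ none = contradiction p (none ⊥)
    ... | inj₂ max  = max

    -- The residual is the greatest solution `m` of `a ∙ m ⊑ c`; by `⊥-zero`, `⊥` is a solution.
    under : ∀ a c → ∃[ m ] a ∙ m ⊑ c × (∀ b → a ∙ b ⊑ c → b ⊑ m)
    under a c = greatest (λ b → a ∙ b ⊑? c) (subst (_⊑ c) (sym (proj₂ (⊥-zero a))) (⊥-min c))

    over : ∀ c b → ∃[ m ] m ∙ b ⊑ c × (∀ a → a ∙ b ⊑ c → a ⊑ m)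
    over c b = greatest (λ a → a ∙ b ⊑? c) (subst (_⊑ c) (sym (proj₁ (⊥-zero b))) (⊥-min c))

  residuatedLattice : ResiduatedLattice
  residuatedLattice = record
    { Carrier     = Carrier
    ; _∧_         = _⊓_
    ; _∨_         = _⊔_
    ; _·_         = _∙_
    ; _\\_        = λ a c → proj₁ (under a c)
    ; _//_        = λ c b → proj₁ (over c b)
    ; e           = e
    ; isLattice   = MinMaxOp.⊔-⊓-isLattice minOperator maxOperator
    ; isMonoid    = isMonoid
    ; residual-\\ = λ a b c → mk⇔
        (λ b≤ → x≤y⇒x⊓y≈x (⊑-trans (mono ⊑-refl (x⊓y≈x⇒x≤y b≤)) (proj₁ (proj₂ (under a c)))))
        (λ ab≤ → x≤y⇒x⊓y≈x (proj₂ (proj₂ (under a c)) b (x⊓y≈x⇒x≤y ab≤)))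
    ; residual-// = λ a b c → mk⇔
        (λ ab≤ → x≤y⇒x⊓y≈x (proj₂ (proj₂ (over c b)) a (x⊓y≈x⇒x≤y ab≤)))
        (λ a≤ → x≤y⇒x⊓y≈x (⊑-trans (mono (x⊓y≈x⇒x≤y a≤) ⊑-refl) (proj₁ (proj₂ (over c b)))))
    }

  isChain : IsIdempotentResiduatedChain residuatedLattice
  isChain = record
    { idempotent = idem
    ; total      = λ x y → Sum.map x≤y⇒x⊓y≈x x≤y⇒x⊓y≈x (total x y)
    }

  -- The order recovered from the lattice is `x ⊓ y ≡ x`, a different type from `x ⊑ y`; the
  -- identity map translates between them.
  chain≃ : T ≃ ChainOrder.tomonoid isChain finite
  chain≃ = record
    { iso     = mk↔ₛ′ (λ x → x) (λ x → x) (λ _ → refl) (λ _ → refl)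
    ; to-mono = x≤y⇒x⊓y≈x
    ; to-∙    = λ _ _ → refl
    }

-- The words of residuated chains

neg-zero : ∀ {w} (x : El (single neg ∷ w)) →
           outer neg -ₛ ⋆ x ≡ outer neg -ₛ × x ⋆ outer neg -ₛ ≡ outer neg -ₛ
neg-zero (inner _)      = refl , refl
neg-zero (outer neg -ₛ) = refl , refl

module Model (w : Word) =
  Residuation (model (single neg ∷ w)) (outer neg -ₛ) (λ _ → bot≼) neg-zero

-- An absorbing element is outer, since outer elements beat inner ones, and a least one is negative.
-- In a double layer its positive partner would win one of their two products.
zero-bottom⇒neg : ∀ {l w} (b : El (l ∷ w)) → (∀ y → b ≼ y) →
                  (∀ y → b ⋆ y ≡ b × y ⋆ b ≡ b) → l ≡ single neg
zero-bottom⇒neg {l} (inner _) _ zeros with inhabited l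
... | s , h with proj₁ (zeros (outer s h))
...   | ()
zero-bottom⇒neg {w = w} (outer pos _) min _ with min (inner (unit w))
... | ()
zero-bottom⇒neg                (outer neg -ₛ)   _ _     = refl
zero-bottom⇒neg {double left}  (outer neg both) _ zeros with proj₂ (zeros (outer pos both))
... | ()
zero-bottom⇒neg {double right} (outer neg both) _ zeros with proj₁ (zeros (outer pos both))
... | ()

model-cardinality : ∀ {w T} → model w ≃ T → suc (size w) ≡ FiniteTomonoid.order T
model-cardinality {w} {T} i =
  ↔⇒≡ (↔-trans (↔-sym (El-finite w)) (↔-trans (_≃_.iso i) (FiniteTomonoid.finite T)))

Sized : ℕ → Set
Sized m = Σ[ w ∈ Word ] size w ≡ m

-- Of the `suc (suc m)` elements one is the unit and one the absorbing bottom, which leaves layers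
-- of total size `m`.
bottomed-word : ∀ {m} (T : FiniteTomonoid) → let open FiniteTomonoid T in
                order ≡ suc (suc m) →
                (∀ {⊥} → (∀ x → ⊥ ⊑ x) → ∀ x → ⊥ ∙ x ≡ ⊥ × x ∙ ⊥ ≡ ⊥) →
                Σ[ w ∈ Sized m ] model (single neg ∷ proj₁ w) ≃ T
bottomed-word {m} T order≡ bottom-zero with ≃-model T
... | [] , i = contradiction (trans (model-cardinality i) order≡) λ ()
... | l ∷ w , i with FiniteTomonoid.least T (λ _ → yes tt)
...   | inj₁ none = contradiction tt (none (FiniteTomonoid.e T))
...   | inj₂ (⊥ , _ , ⊥-min) = finish l≡neg i
  where
  open FiniteTomonoid T
  open _≃_ i
  l≡neg : l ≡ single neg
  l≡neg = zero-bottom⇒neg (from ⊥)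
    (λ y → subst (from ⊥ ≼_) (strictlyInverseʳ y) (from-mono (⊥-min (to y) tt)))
    (λ y → to-injective (begin
        to (from ⊥ ⋆ y)      ≡⟨ to-∙ _ _ ⟩
        to (from ⊥) ∙ to y   ≡⟨ cong (_∙ to y) (strictlyInverseˡ ⊥) ⟩
        ⊥ ∙ to y             ≡⟨ proj₁ (bottom-zero (λ x → ⊥-min x tt) (to y)) ⟩
        ⊥                    ≡⟨ strictlyInverseˡ ⊥ ⟨
        to (from ⊥)          ∎) ,
      to-injective (begin
        to (y ⋆ from ⊥)      ≡⟨ to-∙ _ _ ⟩
        to y ∙ to (from ⊥)   ≡⟨ cong (to y ∙_) (strictlyInverseˡ ⊥) ⟩
        to y ∙ ⊥             ≡⟨ proj₂ (bottom-zero (λ x → ⊥-min x tt) (to y)) ⟩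
        ⊥                    ≡⟨ strictlyInverseˡ ⊥ ⟨
        to (from ⊥)          ∎))
    where open ≡-Reasoning

  finish : l ≡ single neg → model (l ∷ w) ≃ T → Σ[ w ∈ Sized m ] model (single neg ∷ proj₁ w) ≃ T
  finish refl j = (w , suc-injective (suc-injective (trans (model-cardinality j) order≡))) , j

-- Counting words by size

-- The Lucas sequence U(2, −2): 0, 1, 2, 6, 16, 44, …
lucas : ℕ → ℕ
lucas 0             = 0
lucas 1             = 1
lucas (suc (suc m)) = 2 * lucas m + 2 * lucas (suc m)

sized-≡ : ∀ {m} {v w : Sized m} → proj₁ v ≡ proj₁ w → v ≡ w
sized-≡ {v = v , p} {w = _ , q} refl = cong (v ,_) (≡-irrelevant p q)

Sign↔Fin : Sign ↔ Fin 2
Sign↔Fin = mk↔ₛ′ (λ { pos → zero ; neg → suc zero }) (λ { zero → pos ; (suc zero) → neg })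
  (λ { zero → refl ; (suc zero) → refl }) (λ { pos → refl ; neg → refl })

Side↔Fin : Side ↔ Fin 2
Side↔Fin = mk↔ₛ′ (λ { left → zero ; right → suc zero }) (λ { zero → left ; (suc zero) → right })
  (λ { zero → refl ; (suc zero) → refl }) (λ { left → refl ; right → refl })

-- Removing the outermost layer costs 2 if it is double and 1 if it is single, with two choices in
-- either case: the recurrence of `lucas`.
Sized-step : ∀ m → Sized (suc (suc m)) ↔ ((Side × Sized m) ⊎ (Sign × Sized (suc m)))
Sized-step m = mk↔ₛ′ split unsplit split-unsplit unsplit-split
  where
  split : Sized (suc (suc m)) → (Side × Sized m) ⊎ (Sign × Sized (suc m))
  split (double d ∷ w , p) = inj₁ (d , w , suc-injective (suc-injective p))
  split (single s ∷ w , p) = inj₂ (s , w , suc-injective p)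
  unsplit : (Side × Sized m) ⊎ (Sign × Sized (suc m)) → Sized (suc (suc m))
  unsplit (inj₁ (d , w , p)) = double d ∷ w , cong suc (cong suc p)
  unsplit (inj₂ (s , w , p)) = single s ∷ w , cong suc p
  split-unsplit : ∀ x → split (unsplit x) ≡ x
  split-unsplit (inj₁ (d , _)) = cong (λ w → inj₁ (d , w)) (sized-≡ refl)
  split-unsplit (inj₂ (s , _)) = cong (λ w → inj₂ (s , w)) (sized-≡ refl)
  unsplit-split : ∀ x → unsplit (split x) ≡ x
  unsplit-split (double _ ∷ _ , _) = sized-≡ refl
  unsplit-split (single _ ∷ _ , _) = sized-≡ refl

Sized↔Fin : ∀ m → Sized m ↔ Fin (lucas (suc m))
Sized↔Fin 0 = mk↔ₛ′ (λ _ → zero) (λ _ → [] , refl) (λ { zero → refl })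
  λ { ([] , _) → sized-≡ refl ; (single _ ∷ _ , ()) ; (double _ ∷ _ , ()) }
Sized↔Fin 1 = ↔-trans (mk↔ₛ′ head (λ s → single s ∷ [] , refl) (λ _ → refl) head-unique) Sign↔Fin
  where
  head : Sized 1 → Sign
  head (single s ∷ _ , _) = s
  head-unique : ∀ w → (single (head w) ∷ [] , refl) ≡ w
  head-unique (single _ ∷ [] , _)             = sized-≡ refl
  head-unique (single _ ∷ single _ ∷ _ , ())
  head-unique (single _ ∷ double _ ∷ _ , ())
Sized↔Fin (suc (suc m)) = ↔-trans (Sized-step m)
  (↔-trans ((Side↔Fin ×-↔ Sized↔Fin m) ⊎-↔ (Sign↔Fin ×-↔ Sized↔Fin (suc m)))
    (↔-trans (↔-sym *↔× ⊎-↔ ↔-sym *↔×) (↔-sym +↔⊎)))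

-- Isomorphism classes of chains

hasIsoClasses : ∀ m → HasIsoClasses (suc (suc m)) (lucas (suc m))
hasIsoClasses m = record
  { to        = λ A → to (word A)
  ; cong      = λ {A} {B} A≅B → cong to (word-cong A B A≅B)
  ; bijective = (λ {A} {B} eq → word-injective A B (Injection.injective (↔⇒↣ (Sized↔Fin m)) eq)) ,
                -- Surjectivity between setoids concerns every chain isomorphic to the chosen
                -- preimage, hence the use of `word-cong`.
                λ k → let w , p = from k in chainOf w p , λ {B} B≅ →
                  trans (cong to (trans (word-cong B (chainOf w p) B≅) (word-chainOf w p)))
                        (strictlyInverseˡ k)
  }
  where
  open Inverse (Sized↔Fin m) using (to; from; strictlyInverseˡ)
  module Chain (A : IdempotentResiduatedChain (suc (suc m))) where
    open ChainOrder (proj₁ (proj₂ A)) public using (bottom-zero)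
    finite : ResiduatedLattice.Carrier (proj₁ A) ↔ Fin (suc (suc m))
    finite = ⤖⇒↔ (proj₂ (proj₂ A))
    T : FiniteTomonoid
    T = ChainOrder.tomonoid (proj₁ (proj₂ A)) finite
    classified : Σ[ w ∈ Sized m ] model (single neg ∷ proj₁ w) ≃ T
    classified = bottomed-word T refl bottom-zero
  word : IdempotentResiduatedChain (suc (suc m)) → Sized m
  word A = proj₁ (Chain.classified A)

  word-≡ : ∀ {v w : Sized m} → model (single neg ∷ proj₁ v) ≃ model (single neg ∷ proj₁ w) → v ≡ w
  word-≡ i with ≃⇒≡ i
  ... | refl = sized-≡ refl

  word-cong : ∀ A B → proj₁ A ≅ proj₁ B → word A ≡ word B
  word-cong A B A≅B = word-≡ (≃-trans (proj₂ (Chain.classified A))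
    (≃-trans (≅⇒≃ (proj₁ (proj₂ A)) (proj₁ (proj₂ B)) (Chain.finite A) (Chain.finite B) A≅B)
      (≃-sym (proj₂ (Chain.classified B)))))

  word-injective : ∀ A B → word A ≡ word B → proj₁ A ≅ proj₁ B
  word-injective A B eq = ≃⇒≅ (proj₁ (proj₂ A)) (proj₁ (proj₂ B))
    (≃-trans (≃-sym (proj₂ (Chain.classified A)))
      (subst (λ w → model (single neg ∷ proj₁ w) ≃ Chain.T B) (sym eq)
        (proj₂ (Chain.classified B))))

  chainOf : ∀ w → size w ≡ m → IdempotentResiduatedChain (suc (suc m))
  chainOf w p = Model.residuatedLattice w , Model.isChain w ,
    ↔⇒⤖ (subst (λ k → El (single neg ∷ w) ↔ Fin (suc (suc k))) p (El-finite (single neg ∷ w)))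

  word-chainOf : ∀ w p → word (chainOf w p) ≡ (w , p)
  word-chainOf w p = word-≡ (≃-trans (proj₂ (Chain.classified (chainOf w p)))
    -- This only trades the enumeration stored in `chainOf` for `El-finite`, the one in `chain≃`.
    (≃-trans (≅⇒≃ (Model.isChain w) (Model.isChain w) _ (El-finite _) ≅-refl)
      (≃-sym (Model.chain≃ w))))

-- The closed formula

rat : ℕ → ℚ
rat n = ℤ.+ n / 1

-- `_/_` normalises by a gcd that is stuck on variables, so both summands are first put in the form
-- `mkℚ` with denominator 1.
rat-+ : ∀ m n → rat (m + n) ≡ rat m ℚ.+ rat n
rat-+ m n = sym (begin
  rat m ℚ.+ rat n                        ≡⟨ cong₂ ℚ._+_ (reduced m) (reduced n) ⟩
  (ℤ.+ m ℤ.* ℤ.+ 1 ℤ.+ ℤ.+ n ℤ.* ℤ.+ 1) / 1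
    ≡⟨ cong (_/ 1) (cong₂ ℤ._+_ (ℤₚ.*-identityʳ (ℤ.+ m)) (ℤₚ.*-identityʳ (ℤ.+ n))) ⟩
  rat (m + n)                            ∎)
  where
  open ≡-Reasoning
  reduced : ∀ k → rat k ≡ mkℚ (ℤ.+ k) 0 (coprime-sym (1-coprimeTo k))
  reduced k = ℚₚ.normalize-coprime (coprime-sym (1-coprimeTo k))

rat-double : ∀ m → rat (2 * m) ≡ rat m ℚ.+ rat m
rat-double m = trans (rat-+ m (m + 0)) (cong (λ k → rat m ℚ.+ rat k) (+-identityʳ m))

rat-lucas : ∀ k → rat (lucas (suc (suc k))) ≡
              (rat (lucas k) ℚ.+ rat (lucas k)) ℚ.+ (rat (lucas (suc k)) ℚ.+ rat (lucas (suc k)))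
rat-lucas k = trans (rat-+ (2 * lucas k) (2 * lucas (suc k)))
  (cong₂ ℚ._+_ (rat-double (lucas k)) (rat-double (lucas (suc k))))

-- Multiplying `a + b √3` by `1 + √3` gives rational part `a + 3b` and irrational part `a + b`; for
-- the stated coefficients this is one step of the recurrence.
1+√3-power : ∀ k → (fromℕ 1 ⊕ √3) ↑ k ≡
              _+_√3 (rat (lucas (suc k)) ℚ.- rat (lucas k)) (rat (lucas k))
1+√3-power zero    = refl
1+√3-power (suc k) rewrite 1+√3-power k | rat-lucas k =
  cong₂ _+_√3 (rational-part (rat (lucas k)) (rat (lucas (suc k))))
              (irrational-part (rat (lucas k)) (rat (lucas (suc k))))
  where
  open +-*-Solver
  three : ∀ {m} → Polynomial m
  three = con (rat 3)
  one : ∀ {m} → Polynomial m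
  one = con (rat 1)
  rational-part : ∀ x y → rat 1 ℚ.* (y ℚ.- x) ℚ.+ rat 3 ℚ.* (rat 1 ℚ.* x) ≡
                          ((x ℚ.+ x) ℚ.+ (y ℚ.+ y)) ℚ.- y
  rational-part = solve 2 (λ x y →
    one :* (y :- x) :+ three :* (one :* x) := ((x :+ x) :+ (y :+ y)) :- y) refl
  irrational-part : ∀ x y → rat 1 ℚ.* x ℚ.+ rat 1 ℚ.* (y ℚ.- x) ≡ y
  irrational-part = solve 2 (λ x y → one :* x :+ one :* (y :- x) := y) refl

conjugate : ℚ[√3] → ℚ[√3]
conjugate (x + y √3) = _+_√3 x (ℚ.- y)

conjugate-⊗ : ∀ x y → conjugate (x ⊗ y) ≡ conjugate x ⊗ conjugate y
conjugate-⊗ (a + b √3) (c + d √3) = cong₂ _+_√3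
  (solve 4 (λ a b c d → a :* c :+ con (rat 3) :* (b :* d) :=
                        a :* c :+ con (rat 3) :* (:- b :* :- d)) refl a b c d)
  (solve 4 (λ a b c d → :- (a :* d :+ b :* c) := a :* :- d :+ :- b :* c) refl a b c d)
  where open +-*-Solver

conjugate-↑ : ∀ x k → conjugate (x ↑ k) ≡ conjugate x ↑ k
conjugate-↑ x zero    = refl
conjugate-↑ x (suc k) = trans (conjugate-⊗ x (x ↑ k)) (cong (conjugate x ⊗_) (conjugate-↑ x k))

-- The numerator is `2√3` times the irrational part of `z`. The solver equations spell out `_⊘_`: a
-- product with the conjugate `−2√3` of the divisor, then with the inverse norm `i`.
difference-quotient : ∀ z → (z ⊖ conjugate z) ⊘ (fromℕ 2 ⊗ √3) ≡ fromℚ (ℚ[√3].irrational z)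
difference-quotient (x + y √3) = cong₂ _+_√3
  (solve 2 (λ x y →
    let u = (x :- x) :* con (rat 0) :+ con (rat 3) :* ((y :- :- y) :* con (ℚ.- rat 2))
        v = (x :- x) :* con (ℚ.- rat 2) :+ (y :- :- y) :* con (rat 0)
    in  u :* con i :+ con (rat 3) :* (v :* con (rat 0)) := y) refl x y)
  (solve 2 (λ x y →
    let u = (x :- x) :* con (rat 0) :+ con (rat 3) :* ((y :- :- y) :* con (ℚ.- rat 2))
        v = (x :- x) :* con (ℚ.- rat 2) :+ (y :- :- y) :* con (rat 0)
    in  u :* con (rat 0) :+ v :* con i := con (rat 0)) refl x y)
  where
  open +-*-Solver
  -- The inverse of the norm of 2√3.
  i : ℚ
  i = ℤ.-[1+ 0 ] / 12

binet : ∀ k → fromℕ (lucas k) ≡ ((fromℕ 1 ⊕ √3) ↑ k ⊖ (fromℕ 1 ⊖ √3) ↑ k) ⊘ (fromℕ 2 ⊗ √3)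
binet k = sym (begin
  -- `conjugate α` evaluates to `fromℕ 1 ⊖ √3`.
  (α ↑ k ⊖ conjugate α ↑ k) ⊘ 2√3     ≡⟨ cong (λ z → (α ↑ k ⊖ z) ⊘ 2√3) (conjugate-↑ α k) ⟨
  (α ↑ k ⊖ conjugate (α ↑ k)) ⊘ 2√3   ≡⟨ difference-quotient (α ↑ k) ⟩
  fromℚ (ℚ[√3].irrational (α ↑ k))    ≡⟨ cong (fromℚ ∘ ℚ[√3].irrational) (1+√3-power k) ⟩
  fromℕ (lucas k)                         ∎)
  where
  open ≡-Reasoning
  α 2√3 : ℚ[√3]
  α   = fromℕ 1 ⊕ √3
  2√3 = fromℕ 2 ⊗ √3

-- The shift combines two offsets: `n` elements leave layers of size `n ∸ 2`, and words of size `m`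
-- number `lucas (suc m)`.
I : ℕ → ℕ
I n = lucas (n ∸ 1)

I-classes : ∀ n → 2 ≤ n → HasIsoClasses n (I n)
I-classes (suc (suc m)) _ = hasIsoClasses m
I-classes (suc zero) (s≤s ())

I-recurrence : ∀ n → 2 ≤ n → I (n + 2) ≡ 2 * I n + 2 * I (n + 1)
-- Commuting the sums exposes the successors, so that `lucas` unfolds definitionally.
I-recurrence (suc k) _ rewrite +-comm k 2 | +-comm k 1 = refl

theorem4p5 : Σ[ I ∈ (ℕ → ℕ) ] ((∀ n → 2 ≤ n → HasIsoClasses n (I n))
    × (I 2 ≡ 1)
    × (I 3 ≡ 2)
    × (∀ n → 2 ≤ n → I (n + 2) ≡ 2 * I n + 2 * I (n + 1))
    × (∀ n → 2 ≤ n →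
    fromℕ (I n) ≡
    ((fromℕ 1 ⊕ √3) ↑ (n ∸ 1) ⊖ (fromℕ 1 ⊖ √3) ↑ (n ∸ 1))
    ⊘ (fromℕ 2 ⊗ √3)))
theorem4p5 = I , I-classes , refl , refl , I-recurrence , λ n _ → binet (n ∸ 1)
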